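{- Let $I$ and $A$ be types, $f:I\to\mathsf{cotree}(I+A)$ and $i:I$. Then \[\mathsf{iter}\,f\,i = f\,i\mathbin{>\!\!>\!\!=}\big(\lambda lr.\ \text{match } lr \text{ with } \mathsf{inl}\,j\Rightarrow\mathsf{iter}\,f\,j \mid \mathsf{inr}\,x\Rightarrow\mathsf{coleaf}\,x\big).\]
   Context: $\mathsf{cotree}\,X$ is the coinductive type with constructors $\bot$, $\mathsf{coleaf}\,x$, $\mathsf{conode}\,k$ ($k:\mathbb{B}\to\mathsf{cotree}\,X$), ordered coinductively by $\bot\sqsubseteq t$, $\mathsf{coleaf}\,x\sqsubseteq\mathsf{coleaf}\,x$, $\mathsf{conode}\,f\sqsubseteq\mathsf{conode}\,g$ when $f\,b\sqsubseteq g\,b$ for all $b$; order-equivalent cotrees are assumed equal (axiom). Bind: $\bot\mathbin{>\!\!>\!\!=}k=\bot$, $\mathsf{coleaf}\,a\mathbin{>\!\!>\!\!=}k=k\,a$, $\mathsf{conode}\,g\mathbin{>\!\!>\!\!=}k=\mathsf{conode}(\lambda b.\,g\,b\mathbin{>\!\!>\!\!=}k)$ (corecursively). Define $F:(I\to\mathsf{cotree}\,A)\to I\to\mathsf{cotree}\,A$ by $F\,g\,i:=f\,i\mathbin{>\!\!>\!\!=}(\lambda lr.\ \text{match } lr \text{ with } \mathsf{inl}\,j\Rightarrow g\,j\mid\mathsf{inr}\,x\Rightarrow\mathsf{coleaf}\,x)$, and $\mathsf{iter}\,f\,z:=\sup_n\big(F^n(\lambda\_.\bot)\,z\big)$, a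 supremum (chosen by choice) in $\mathsf{cotree}\,A$ of the sequence $n\mapsto F^n(\lambda\_.\bot)\,z$. -}

module Defs where

open import Data.Bool using (Bool)
open import Data.List using (List; []; _∷_)
open import Data.Nat using (ℕ; zero; suc)
open import Data.Sum using (_⊎_; inj₁; inj₂)
open import Data.Product using (_×_)
open import Relation.Binary.PropositionalEquality using (_≡_)

-- cotree X : the final coalgebra of  Y ↦ 1 + X + (Bool → Y).
--
-- Coinductive types are unavailable here (the flag --guardedness is not
-- allowed), so a cotree is represented by its observations: the shape of
-- the node reached by following a path (a list of Booleans, read from the
-- root).  Positions below a bot / coleaf node are unreachable and ignored
-- by everything below (in particular by the order ⊑).

data Shape (X : Set) : Set where
  bot  : Shape X
  leaf : X → Shape X
  node : Shape X

record Cotree (X : Set) : Set where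
  constructor mk
  field at : List Bool → Shape X

open Cotree public

⊥t : {X : Set} → Cotree X
at ⊥t _ = bot

coleaf : {X : Set} → X → Cotree X
at (coleaf x) []      = leaf x
at (coleaf x) (_ ∷ _) = bot

conode : {X : Set} → (Bool → Cotree X) → Cotree X
at (conode k) []      = node
at (conode k) (b ∷ p) = at (k b) p

child : {X : Set} → Cotree X → Bool → Cotree X
at (child t b) p = at t (b ∷ p)

-- The coinductive order, as the intersection of its ω approximants
-- (the rules are: ⊥ ⊑ t ;  coleaf x ⊑ coleaf x ;
--  conode f ⊑ conode g  if  f b ⊑ g b  for all b).

data _⊑[_]_ {X : Set} : Cotree X → ℕ → Cotree X → Set where
  stop  : ∀ {t u} → t ⊑[ zero ] u
  bot⊑  : ∀ {t u n} → at t [] ≡ bot → t ⊑[ suc n ] u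
  leaf⊑ : ∀ {t u n x} → at t [] ≡ leaf x → at u [] ≡ leaf x → t ⊑[ suc n ] u
  node⊑ : ∀ {t u n} → at t [] ≡ node → at u [] ≡ node →
          (∀ b → child t b ⊑[ n ] child u b) → t ⊑[ suc n ] u

_⊑_ : {X : Set} → Cotree X → Cotree X → Set
t ⊑ u = ∀ n → t ⊑[ n ] u

-- Order-equivalence.  The paper postulates that order-equivalent cotrees
-- are equal; accordingly this is the equality of cotrees we use.
_≈_ : {X : Set} → Cotree X → Cotree X → Set
s ≈ t = (s ⊑ t) × (t ⊑ s)

-- Monadic bind:  ⊥ >>= k = ⊥ ; coleaf a >>= k = k a ;
--                conode g >>= k = conode (λ b → g b >>= k)

bindAt : {A B : Set} → Cotree A → (A → Cotree B) → List Bool → Shape B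
bindAt t k p with at t []
... | bot    = bot
... | leaf a = at (k a) p
bindAt t k []      | node = node
bindAt t k (b ∷ p) | node = bindAt (child t b) k p

_>>=_ : {A B : Set} → Cotree A → (A → Cotree B) → Cotree B
at (t >>= k) = bindAt t k

IsUpperBound : {X : Set} → (ℕ → Cotree X) → Cotree X → Set
IsUpperBound s u = ∀ n → s n ⊑ u

IsSup : {X : Set} → (ℕ → Cotree X) → Cotree X → Set
IsSup s u = IsUpperBound s u × (∀ v → IsUpperBound s v → u ⊑ v)

Chain : {X : Set} → (ℕ → Cotree X) → Set
Chain s = ∀ n → s n ⊑ s (suc n)

cont : {I A : Set} → (I → Cotree A) → I ⊎ A → Cotree A
cont g (inj₁ j) = g j
cont g (inj₂ x) = coleaf x

F : {I A : Set} → (I → Cotree (I ⊎ A)) → (I → Cotree A) → I → Cotree A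
F f g i = f i >>= cont g

approx : {I A : Set} → (I → Cotree (I ⊎ A)) → ℕ → I → Cotree A
approx f zero    = λ _ → ⊥t
approx f (suc n) = F f (approx f n)

-- iter f z = sup_n (F^n (λ _ → ⊥) z), relative to a supremum operator
-- `sup` (playing the role of the supremum chosen by choice)
iter : {I A : Set} → ((ℕ → Cotree A) → Cotree A) →
       (I → Cotree (I ⊎ A)) → I → Cotree A
iter sup f z = sup (λ n → approx f n z)

-- The approximants F^n ⊥ form a chain, so iter f is their pointwise supremum.
-- Bind is monotone and continuous in its continuation, hence F preserves this
-- supremum: F (iter f) is the supremum of the F^(n+1) ⊥, which is iter f again.
module Submission where

open import Defs
open import Data.Nat using (ℕ; zero; suc)
open import Data.Sum using (_⊎_; inj₁; inj₂)
open import Data.List using ([]; _∷_)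
open import Data.Product using (_,_; proj₁; proj₂)
open import Function using (_∘_)
open import Relation.Binary.PropositionalEquality
  using (_≡_; _≗_; refl; sym; trans)

private variable
  X A B : Set
  m : ℕ

⊑[]-resp : {t t′ u u′ : Cotree X} →
           at t ≗ at t′ → at u ≗ at u′ → t ⊑[ m ] u → t′ ⊑[ m ] u′
⊑[]-resp t≗ u≗ stop = stop
⊑[]-resp t≗ u≗ (bot⊑ e) = bot⊑ (trans (sym (t≗ [])) e)
⊑[]-resp t≗ u≗ (leaf⊑ e e′) = leaf⊑ (trans (sym (t≗ [])) e) (trans (sym (u≗ [])) e′)
⊑[]-resp t≗ u≗ (node⊑ e e′ h) =
  node⊑ (trans (sym (t≗ [])) e) (trans (sym (u≗ [])) e′)
        (λ b → ⊑[]-resp (λ p → t≗ (b ∷ p)) (λ p → u≗ (b ∷ p)) (h b))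

⊑-refl : (t : Cotree X) → t ⊑ t
⊑-refl t zero = stop
⊑-refl t (suc m) with at t [] in e
... | bot    = bot⊑ e
... | leaf x = leaf⊑ e e
... | node   = node⊑ e e (λ b → ⊑-refl (child t b) m)

⊥t-least : (t : Cotree X) → ⊥t ⊑ t
⊥t-least t zero    = stop
⊥t-least t (suc m) = bot⊑ refl

⊑-node-inv : {t u : Cotree X} → t ⊑[ suc m ] u → at t [] ≡ node → at u [] ≡ node
⊑-node-inv (bot⊑ e)       e′ with () ← trans (sym e) e′
⊑-node-inv (leaf⊑ e _)    e′ with () ← trans (sym e) e′
⊑-node-inv (node⊑ _ e′ _) _  = e′

⊑-child-inv : {t u : Cotree X} → t ⊑[ suc m ] u → at t [] ≡ node →
              ∀ b → child t b ⊑[ m ] child u b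
⊑-child-inv (bot⊑ e)      e′ with () ← trans (sym e) e′
⊑-child-inv (leaf⊑ e _)   e′ with () ← trans (sym e) e′
⊑-child-inv (node⊑ _ _ h) _  = h

module _ (t : Cotree A) (k : A → Cotree B) where

  >>=-bot : at t [] ≡ bot → at (t >>= k) [] ≡ bot
  >>=-bot e with at t [] | e
  ... | .bot | refl = refl

  >>=-leaf : ∀ {a} → at t [] ≡ leaf a → at (t >>= k) ≗ at (k a)
  >>=-leaf e p with at t [] | e
  ... | .(leaf _) | refl = refl

  >>=-node : at t [] ≡ node → at (t >>= k) [] ≡ node
  >>=-node e with at t [] | e
  ... | .node | refl = refl

  >>=-child : at t [] ≡ node → ∀ b → at (child t b >>= k) ≗ at (child (t >>= k) b)
  >>=-child e b p with at t [] | e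
  ... | .node | refl = refl

>>=-monoʳ : (t : Cotree A) {k k′ : A → Cotree B} → (∀ a → k a ⊑ k′ a) →
            (t >>= k) ⊑ (t >>= k′)
>>=-monoʳ t k⊑k′ zero = stop
>>=-monoʳ t {k} {k′} k⊑k′ (suc m) with at t [] in e
... | bot    = bot⊑ (>>=-bot t k e)
... | leaf a = ⊑[]-resp (λ p → sym (>>=-leaf t k e p)) (λ p → sym (>>=-leaf t k′ e p))
                        (k⊑k′ a (suc m))
... | node   = node⊑ (>>=-node t k e) (>>=-node t k′ e)
                     (λ b → ⊑[]-resp (>>=-child t k e b) (>>=-child t k′ e b)
                                     (>>=-monoʳ (child t b) k⊑k′ m))

>>=-lubʳ : (t : Cotree A) (k : ℕ → A → Cotree B) (k∞ : A → Cotree B) →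
           (∀ a v → IsUpperBound (λ n → k n a) v → k∞ a ⊑ v) →
           ∀ v → IsUpperBound (λ n → t >>= k n) v → (t >>= k∞) ⊑ v
>>=-lubʳ t k k∞ least v ub zero = stop
>>=-lubʳ t k k∞ least v ub (suc m) with at t [] in e
... | bot    = bot⊑ (>>=-bot t k∞ e)
... | leaf a = ⊑[]-resp (λ p → sym (>>=-leaf t k∞ e p)) (λ _ → refl)
                 (least a v (λ n → ⊑[]-resp (>>=-leaf t (k n) e) (λ _ → refl) ∘ ub n) (suc m))
... | node   = node⊑ (>>=-node t k∞ e) (⊑-node-inv (ub 0 1) (>>=-node t (k 0) e))
                 (λ b → ⊑[]-resp (>>=-child t k∞ e b) (λ _ → refl)
                          (>>=-lubʳ (child t b) k k∞ least (child v b) (ubChild b) m))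
  where
  ubChild : ∀ b → IsUpperBound (λ n → child t b >>= k n) (child v b)
  ubChild b n m′ = ⊑[]-resp (λ p → sym (>>=-child t (k n) e b p)) (λ _ → refl)
                            (⊑-child-inv (ub n (suc m′)) (>>=-node t (k n) e) b)

cont-monoʳ : {I : Set} {g g′ : I → Cotree A} → (∀ j → g j ⊑ g′ j) →
             ∀ lr → cont g lr ⊑ cont g′ lr
cont-monoʳ g⊑g′ (inj₁ j) = g⊑g′ j
cont-monoʳ g⊑g′ (inj₂ x) = ⊑-refl (coleaf x)

cont-lubʳ : {I : Set} (g : ℕ → I → Cotree A) (g∞ : I → Cotree A) →
            (∀ j v → IsUpperBound (λ n → g n j) v → g∞ j ⊑ v) →
            ∀ lr v → IsUpperBound (λ n → cont (g n) lr) v → cont g∞ lr ⊑ v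
cont-lubʳ g g∞ least (inj₁ j) v ub = least j v ub
cont-lubʳ g g∞ least (inj₂ x) v ub = ub 0

module _ {I A : Set} (sup : (ℕ → Cotree A) → Cotree A)
         (sup-isSup : (s : ℕ → Cotree A) → Chain s → IsSup s (sup s))
         (f : I → Cotree (I ⊎ A)) where

  approx-chain : ∀ j → Chain (λ n → approx f n j)
  approx-chain j zero    = ⊥t-least _
  approx-chain j (suc n) = >>=-monoʳ (f j) (cont-monoʳ (λ j′ → approx-chain j′ n))

  iter-isSup : ∀ j → IsSup (λ n → approx f n j) (iter sup f j)
  iter-isSup j = sup-isSup (λ n → approx f n j) (approx-chain j)

  iter⊑F-iter : ∀ i → iter sup f i ⊑ F f (iter sup f) i
  iter⊑F-iter i = proj₂ (iter-isSup i) _ λ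
    { zero    → ⊥t-least _
    ; (suc n) → >>=-monoʳ (f i) (cont-monoʳ (λ j → proj₁ (iter-isSup j) n)) }

  F-iter⊑iter : ∀ i → F f (iter sup f) i ⊑ iter sup f i
  F-iter⊑iter i =
    >>=-lubʳ (f i) (cont ∘ approx f) (cont (iter sup f))
             (cont-lubʳ (approx f) (iter sup f) (proj₂ ∘ iter-isSup))
             (iter sup f i) (proj₁ (iter-isSup i) ∘ suc)

mainTheorem18 : {I A : Set}
    → (sup : (ℕ → Cotree A) → Cotree A)
    → (sup-isSup : (s : ℕ → Cotree A) → Chain s → IsSup s (sup s))
    → (f : I → Cotree (I ⊎ A)) (i : I)
    → iter sup f i ≈ (f i >>= cont (iter sup f))
mainTheorem18 sup sup-isSup f i =
  iter⊑F-iter sup sup-isSup f i , F-iter⊑iter sup sup-isSup f i
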